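{- Let $\kappa$ be an infinite cardinal, $\lambda$ a cardinal, and assume: (a) $\theta=\operatorname{cf}(\lambda)\le\kappa<\lambda$; (b) $\langle\lambda_i:i<\kappa\rangle$ is a sequence of infinite cardinals; (c) $\lim_D(\langle\lambda_i:i<\kappa\rangle)=\lambda$; (d) $\lambda_i^{\kappa}<\lambda$ for every $i<\kappa$; (e) $D$ is an ultrafilter on $\kappa$; (f) $D$ is not closed under descending sequences of length $\theta$; (g) $\left|\prod_{i<\kappa}\lambda_i/D\right|=\lambda$. Then $D$ is $(\kappa,\theta)$-weakly normal.
   Context: Limit along $D$: for a sequence $\bar\lambda=\langle\lambda_i:i<\kappa\rangle$ of cardinals, $\lim_D(\bar\lambda)$ is the unique cardinal $\mu$ such that $\{i<\kappa:\beta<\lambda_i\le\mu\}\in D$ for every $\beta<\mu$. $D$ is not closed under descending sequences of length $\theta$ if there is a $\subseteq$-decreasing sequence $\langle A_\epsilon:\epsilon<\theta\rangle$ of members of $D$ with $\bigcap_{\epsilon<\theta}A_\epsilon\notin D$. $\prod_{i<\kappa}\lambda_i/D$ is the ultraproduct of the sets $\lambda_i$ modulo $D$. Regressive functions: for $g:\kappa\to\theta$, a function $f:\kappa\to\theta$ is $(\kappa,g)$-regressive if $f(i)<g(i)$ for every $i<\kappa$ with $g(i)>0$. Weak normality: let $g:\kappa\to\theta$. $D$ is $(\kappa,g)$-weakly normal if (i) for every $\epsilon<\theta$, $\{i<\kappa: g(i)\ge\epsilon\}\in D$; and (ii) for every $(\kappa,g)$-regressive $f:\kappa\to\theta$ there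 is $j_f<\theta$ such that $\{i<\kappa: f(i)<j_f\}\in D$. $D$ is $(\kappa,\theta)$-weakly normal if it is $(\kappa,g)$-weakly normal for some $g:\kappa\to\theta$. -}

module Defs where

open import Level using (Level) renaming (suc to lsuc)
open import Data.Fin.Base using (Fin)
open import Data.Product using (Σ; ∃; ∃-syntax; _×_; _,_; proj₁)
open import Data.Sum using (_⊎_)
open import Function.Base using (_on_)
open import Function.Bundles using (_⤖_; Bijection)
open import Induction.WellFounded using (WellFounded)
open import Relation.Binary.Bundles using (Setoid)
open import Relation.Binary.Core using (Rel)
open import Relation.Binary.Definitions using (Irrelevant; Trichotomous; Tri; tri<; tri≈; tri>)
open import Relation.Binary.Morphism.Structures using (IsOrderIsomorphism)
open import Relation.Binary.PropositionalEquality using (_≡_; refl; sym; trans; cong; isEquivalence; setoid)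
open import Relation.Binary.Structures using (IsStrictTotalOrder)
open import Relation.Nullary using (¬_)
open import Relation.Unary using (Pred; _∈_; _∉_; _⊆_; _∩_; ∁; ⋂)
open import Relation.Unary.Polymorphic using (∅; U)
import Relation.Binary.Construct.On as On
import Relation.Binary.Construct.StrictToNonStrict as ToNonStrict

-- An ordinal is a well-ordered type, and ordinals are compared up to order
-- isomorphism.  Its elements play the role of the smaller ordinals, the
-- element a standing for the initial segment α ↓ a.  The order must be
-- proof-irrelevant so that α ↓ a has exactly the elements below a.

record Ordinal (ℓ : Level) : Set (lsuc ℓ) where
  infix 4 _<_ _≤_
  field
    Carrier            : Set ℓ
    _<_                : Rel Carrier ℓ
    isStrictTotalOrder : IsStrictTotalOrder _≡_ _<_
    wellFounded        : WellFounded _<_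
    <-irrelevant       : Irrelevant _<_

  open IsStrictTotalOrder isStrictTotalOrder public
    using (compare) renaming (trans to <-trans)

  _≤_ : Rel Carrier ℓ
  _≤_ = ToNonStrict._≤_ _≡_ _<_

private
  variable
    ℓ : Level

infixl 7 _↓_
_↓_ : (α : Ordinal ℓ) → Ordinal.Carrier α → Ordinal ℓ
_↓_ {ℓ} α a = record
  { Carrier            = ∃ (_< a)
  ; _<_                = _<_ on proj₁
  ; isStrictTotalOrder = record
    { isStrictPartialOrder = record
      { isEquivalence = isEquivalence
      ; irrefl        = λ { refl → irrefl refl }
      ; trans         = <-trans
      ; <-resp-≈      = (λ { refl p → p }) , (λ { refl p → p })
      }
    ; compare = cmp
    }
  ; wellFounded  = On.wellFounded proj₁ wellFounded
  ; <-irrelevant = <-irrelevant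
  }
  where
  open Ordinal α
  open IsStrictTotalOrder isStrictTotalOrder using (irrefl)

  cmp : Trichotomous {A = ∃ (_< a)} _≡_ (_<_ on proj₁)
  cmp (x , p) (y , q) with compare x y
  ... | tri< x<y x≢y x≯y = tri< x<y (λ e → x≢y (cong proj₁ e)) x≯y
  ... | tri> x≮y x≢y x>y = tri> x≮y (λ e → x≢y (cong proj₁ e)) x>y
  ... | tri≈ x≮y refl x≯y = tri≈ x≮y (cong (x ,_) (<-irrelevant p q)) x≯y

infix 4 _≅_ _<ᵒ_ _≤ᵒ_

_≅_ : Rel (Ordinal ℓ) ℓ
α ≅ β = ∃[ f ] IsOrderIsomorphism _≡_ _≡_ (Ordinal._<_ α) (Ordinal._<_ β) f

_<ᵒ_ : Rel (Ordinal ℓ) ℓ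
α <ᵒ β = ∃[ b ] α ≅ β ↓ b

_≤ᵒ_ : Rel (Ordinal ℓ) ℓ
α ≤ᵒ β = α <ᵒ β ⊎ α ≅ β

-- Cardinals are initial ordinals.

record Cardinal (ℓ : Level) : Set (lsuc ℓ) where
  field
    ordinal : Ordinal ℓ

  open Ordinal ordinal public

  field
    initial : ∀ a → ¬ (Ordinal.Carrier (ordinal ↓ a) ⤖ Carrier)

open Cardinal public using () renaming (ordinal to ord; Carrier to ∣_∣)

Infinite : Cardinal ℓ → Set ℓ
Infinite κ = ¬ (∃[ n ] Fin n ⤖ ∣ κ ∣)

-- The cardinality of the quotient of the carrier of S by its equality is μ.

HasCardinality : Setoid ℓ ℓ → Cardinal ℓ → Set ℓ
HasCardinality S μ = Bijection (setoid ∣ μ ∣) S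

CofinalMap : Ordinal ℓ → Ordinal ℓ → Set ℓ
CofinalMap η α = Σ (Ordinal.Carrier η → Ordinal.Carrier α)
                   λ c → ∀ a → ∃[ e ] Ordinal._≤_ α a (c e)

IsCofinality : Ordinal ℓ → Ordinal ℓ → Set (lsuc ℓ)
IsCofinality θ α = CofinalMap θ α × (∀ η → CofinalMap η α → θ ≤ᵒ η)

record IsUltrafilter {I : Set ℓ} (D : Pred (Pred I ℓ) ℓ) : Set (lsuc ℓ) where
  field
    U∈       : U ∈ D
    ∅∉       : ∅ ∉ D
    ∩-closed : ∀ {A B} → A ∈ D → B ∈ D → A ∩ B ∈ D
    ⊆-closed : ∀ {A B} → A ⊆ B → A ∈ D → B ∈ D
    ultra    : ∀ A → A ∈ D ⊎ ∁ A ∈ D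

-- The ultraproduct as a setoid, since quotient types are not available:
-- choice functions, with equality on a set in D.

Ultraproduct : {I : Set ℓ} {D : Pred (Pred I ℓ) ℓ} →
               IsUltrafilter D → (I → Set ℓ) → Setoid ℓ ℓ
Ultraproduct {D = D} isUF X = record
  { Carrier       = ∀ i → X i
  ; _≈_           = λ f g → (λ i → f i ≡ g i) ∈ D
  ; isEquivalence = record
    { refl  = ⊆-closed (λ _ → refl) U∈
    ; sym   = ⊆-closed sym
    ; trans = λ p q → ⊆-closed (λ (e , e′) → trans e e′) (∩-closed p q)
    }
  }
  where open IsUltrafilter isUF

-- μ is the limit along D of the sequence λs.  Uniqueness of μ is not part of
-- the definition: among nonzero cardinals it is automatic, whereas 0
-- satisfies the condition vacuously for every sequence.

IsLimitAlong : {I : Set ℓ} → Pred (Pred I ℓ) ℓ → (I → Cardinal ℓ) → Cardinal ℓ → Set (lsuc ℓ)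
IsLimitAlong D λs μ =
  ∀ β → β <ᵒ ord μ → (λ i → β <ᵒ ord (λs i) × ord (λs i) ≤ᵒ ord μ) ∈ D

NotClosedUnderDescending : {I : Set ℓ} → Pred (Pred I ℓ) ℓ → Ordinal ℓ → Set (lsuc ℓ)
NotClosedUnderDescending {ℓ} {I} D θ =
  Σ (Ordinal.Carrier θ → Pred I ℓ) λ A →
    (∀ {δ ε} → Ordinal._<_ θ δ ε → A ε ⊆ A δ) ×
    (∀ ε → A ε ∈ D) ×
    ⋂ (Ordinal.Carrier θ) A ∉ D

module _ {I : Set ℓ} (θ : Ordinal ℓ) where
  open Ordinal θ

  -- The hypothesis "0 < g i" is expressed as: some element lies below g i.

  Regressive : (g f : I → Carrier) → Set ℓ
  Regressive g f = ∀ i → (∃[ z ] z < g i) → f i < g i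

  WeaklyNormalAt : Pred (Pred I ℓ) ℓ → (g : I → Carrier) → Set ℓ
  WeaklyNormalAt D g =
    (∀ ε → (λ i → ε ≤ g i) ∈ D) ×
    (∀ f → Regressive g f → ∃[ j ] (λ i → f i < j) ∈ D)

  WeaklyNormal : Pred (Pred I ℓ) ℓ → Set ℓ
  WeaklyNormal D = ∃[ g ] WeaklyNormalAt D g

{-# OPTIONS --safe #-}

-- Let c : θ → Λ be nondecreasing and cofinal, and let g i be the least ε such
-- that λᵢ ≤ c ε; then g is unbounded modulo D because lim_D λᵢ = Λ.  Suppose a
-- regressive f is not bounded modulo D, and let ⟨F a : a < Λ⟩ be any Λ elements
-- of the product.  Regressivity gives c (f i) < λᵢ, so some h i in λᵢ differs
-- from F a i for all a < c (f i).  Each a is below c (f i) for D-almost all i,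
-- hence h is equal modulo D to no F a, and the ultraproduct is not of size Λ.

module Submission where

open import Defs
open import Level using (Level)
open import Axiom.DoubleNegationElimination using (em⇒dne)
open import Axiom.ExcludedMiddle using (ExcludedMiddle)
open import Axiom.Extensionality.Propositional using (Extensionality)
open import Data.Product using (∃; ∃-syntax; _×_; _,_; proj₁; proj₂)
open import Data.Sum using (inj₁; inj₂; [_,_]′)
open import Function.Base using (_∘_; id; const)
open import Function.Bundles using (_⤖_; mk⤖; _↣_; mk↣; Injection; Surjection; mk↠ₛ; Bijection)
open import Function.Consequences.Propositional using (strictlySurjective⇒surjective)
open import Function.Construct.Composition using (_↣-∘_)
open import Function.Definitions using (StrictlySurjective)
open import Function.Properties.Bijection using (sym-≡)
open import Induction.WellFounded using (module All)
open import Relation.Binary.Bundles using (Setoid)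
open import Relation.Binary.Core using (_Preserves_⟶_)
open import Relation.Binary.Definitions using (Trans; tri<; tri≈; tri>)
open import Relation.Binary.Morphism.Structures using (IsOrderIsomorphism)
open import Relation.Binary.PropositionalEquality
  using (_≡_; _≢_; refl; sym; trans; cong; subst; subst₂; respʳ; respˡ; setoid; _→-setoid_)
open import Relation.Binary.Structures using (IsStrictTotalOrder; IsTotalOrder)
open import Relation.Nullary using (¬_; Dec; yes; no; contradiction)
open import Relation.Unary using (Pred; _∈_; ∁; Irrelevant; Satisfiable)
import Relation.Binary.Construct.StrictToNonStrict as ToNonStrict

private
  variable
    ℓ : Level
    A B : Set ℓ

-- Well-orders and strictly increasing maps on initial segments.

module OrdinalProperties (α : Ordinal ℓ) where
  open Ordinal α
  open IsStrictTotalOrder isStrictTotalOrder public using (irrefl)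
  open IsTotalOrder (ToNonStrict.isTotalOrder _≡_ _<_ isStrictTotalOrder) public
    using () renaming (trans to ≤-trans)

  <-≤-trans : Trans _<_ _≤_ _<_
  <-≤-trans = ToNonStrict.<-≤-trans _≡_ _<_ <-trans (respʳ _<_)

  ≤-<-trans : Trans _≤_ _<_ _<_
  ≤-<-trans = ToNonStrict.≤-<-trans _≡_ _<_ sym <-trans (respˡ _<_)

  ≤⇒≯ : ∀ {x y} → x ≤ y → ¬ y < x
  ≤⇒≯ x≤y y<x = irrefl refl (≤-<-trans x≤y y<x)

  ≮⇒≥ : ∀ {x y} → ¬ x < y → y ≤ x
  ≮⇒≥ {x} {y} x≮y with compare x y
  ... | tri< x<y _ _ = contradiction x<y x≮y
  ... | tri≈ _ x≡y _ = inj₂ (sym x≡y)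
  ... | tri> _ _ y<x = inj₁ y<x

  ≰⇒> : ∀ {x y} → ¬ x ≤ y → y < x
  ≰⇒> {x} {y} x≰y with compare x y
  ... | tri< x<y _ _ = contradiction (inj₁ x<y) x≰y
  ... | tri≈ _ x≡y _ = contradiction (inj₂ x≡y) x≰y
  ... | tri> _ _ y<x = y<x

  upperBound : ∀ x y → ∃[ z ] x ≤ z × y ≤ z
  upperBound x y with compare x y
  ... | tri< x<y _ _ = y , inj₁ x<y , inj₂ refl
  ... | tri≈ _ x≡y _ = y , inj₂ x≡y , inj₂ refl
  ... | tri> _ _ y<x = x , inj₂ refl , inj₁ y<x

  least : ExcludedMiddle ℓ → (P : Pred Carrier ℓ) → Satisfiable P →
          ∃[ m ] P m × (∀ {x} → P x → m ≤ x)
  least em P (x , Px) = All.wfRec wellFounded _ (λ x → P x → Least) step x Px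
    where
    Least : Set _
    Least = ∃[ m ] P m × (∀ {x} → P x → m ≤ x)

    step : ∀ x → (∀ {y} → y < x → P y → Least) → P x → Least
    step x smaller Px with em {∃[ y ] y < x × P y}
    ... | yes (y , y<x , Py) = smaller y<x Py
    ... | no none = x , Px , λ Py → ≮⇒≥ λ y<x → none (_ , y<x , Py)

  -- If `f x < x`, monotonicity gives `f (f x) < f x`, against the induction hypothesis at `f x`.
  ↓-inflationary : ∀ {a} (f : ∃ (_< a) → Carrier) →
                   f Preserves Ordinal._<_ (α ↓ a) ⟶ _<_ →
                   ∀ p → proj₁ p ≤ f p
  ↓-inflationary {a} f f-mono (x , x<a) =
    All.wfRec wellFounded _ (λ x → (x<a : x < a) → x ≤ f (x , x<a)) step x x<a
    where
    step : ∀ x → (∀ {y} → y < x → (y<a : y < a) → y ≤ f (y , y<a)) →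
           (x<a : x < a) → x ≤ f (x , x<a)
    step x below x<a = ≮⇒≥ λ fx<x →
      let fx<a = <-trans fx<x x<a
      in ≤⇒≯ (below fx<x fx<a) (f-mono {_ , fx<a} {x , x<a} fx<x)

  ↓-strictBound : ∀ {a y} (f : ∃ (_< a) → Carrier) →
                  f Preserves Ordinal._<_ (α ↓ a) ⟶ _<_ →
                  (∀ p → f p < y) → a ≤ y
  ↓-strictBound f f-mono f<y = ≮⇒≥ λ y<a →
    ≤⇒≯ (↓-inflationary f f-mono (_ , y<a)) (f<y (_ , y<a))

  no-<-preserving-below : ∀ {a} (f : Carrier → Carrier) → f Preserves _<_ ⟶ _<_ →
                          ¬ (∀ x → f x < a)
  no-<-preserving-below {a} f f-mono f<a =
    ≤⇒≯ (↓-inflationary (f ∘ proj₁) f-mono (f a , f<a a)) (f-mono (f<a a))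

  -- Followed by inclusions, such an isomorphism would be a strictly increasing self-map of `α` with
  -- all values below `a`; it would move `a` itself down.
  ≰ᵒ↓ : ∀ {a} → ¬ (α ≤ᵒ α ↓ a)
  ≰ᵒ↓ (inj₁ (b , f , iso)) =
    no-<-preserving-below (proj₁ ∘ proj₁ ∘ f) (IsOrderIsomorphism.mono iso) (proj₂ ∘ proj₁ ∘ f)
  ≰ᵒ↓ (inj₂ (f , iso)) =
    no-<-preserving-below (proj₁ ∘ f) (IsOrderIsomorphism.mono iso) (proj₂ ∘ f)

-- Comparison of sizes.

≅⇒⤖ : (α β : Ordinal ℓ) → α ≅ β → Ordinal.Carrier α ⤖ Ordinal.Carrier β
≅⇒⤖ _ _ (_ , iso) = mk⤖ (injective , surjective)
  where open IsOrderIsomorphism iso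

-- Each `f x` goes to a chosen preimage under `s`. Equal preimages have equivalent images, so `to⁻`
-- need not respect the equality of `S`.
liftInjection : {S : Setoid ℓ ℓ} → Surjection (setoid A) S →
                (f : B → Setoid.Carrier S) →
                (∀ {x y} → Setoid._≈_ S (f x) (f y) → x ≡ y) → B ↣ A
liftInjection {S = S} s f f-inj = mk↣ {to = to⁻ ∘ f} λ {x} {y} eq →
  f-inj (S.trans (S.sym (proj₂ (strictlySurjective (f x))))
          (S.trans (cong′ eq) (proj₂ (strictlySurjective (f y)))))
  where
  open Surjection s using (to⁻; strictlySurjective) renaming (cong to cong′)
  module S = Setoid S

data ForwardOrbit {A : Set ℓ} (f : A → A) (S : Pred A ℓ) : Pred A ℓ where
  base : ∀ {x} → x ∈ S → ForwardOrbit f S x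
  step : ∀ {x} → ForwardOrbit f S x → ForwardOrbit f S (f x)

-- The special case of the Cantor–Bernstein theorem in which the reverse
-- injection is an inclusion: j is applied exactly on the forward orbit of the
-- complement of P.
injection-into-subset : ExcludedMiddle ℓ → {A : Set ℓ} {P : Pred A ℓ} →
                        Irrelevant P → A ↣ ∃ P → A ⤖ ∃ P
injection-into-subset {ℓ} em {A} {P} irr j =
  mk⤖ (φ-injective em em , strictlySurjective⇒surjective λ y → φ-surjective y em)
  where
  open Injection j using (to; injective)

  Orbit : Pred A ℓ
  Orbit = ForwardOrbit (proj₁ ∘ to) (∁ P)

  ∉Orbit⇒P : ∀ {x} → ¬ Orbit x → P x
  ∉Orbit⇒P x∉ = em⇒dne em (x∉ ∘ base)

  pick : ∀ x → Dec (Orbit x) → ∃ P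
  pick x (yes _)  = to x
  pick x (no x∉) = x , ∉Orbit⇒P x∉

  φ : A → ∃ P
  φ x = pick x em

  φ-injective : ∀ {x y} (d : Dec (Orbit x)) (d′ : Dec (Orbit y)) →
                pick x d ≡ pick y d′ → x ≡ y
  φ-injective (yes _)  (yes _)  eq = injective eq
  φ-injective (yes x∈) (no y∉)  eq = contradiction (subst Orbit (cong proj₁ eq) (step x∈)) y∉
  φ-injective (no x∉)  (yes y∈) eq = contradiction (subst Orbit (cong proj₁ (sym eq)) (step y∈)) x∉
  φ-injective (no _)   (no _)   eq = cong proj₁ eq

  pick-∈ : ∀ {x} → Orbit x → (d : Dec (Orbit x)) → pick x d ≡ to x
  pick-∈ _  (yes _)  = refl
  pick-∈ x∈ (no x∉) = contradiction x∈ x∉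

  pick-∉ : ∀ {x} (Px : P x) → ¬ Orbit x → (d : Dec (Orbit x)) → pick x d ≡ (x , Px)
  pick-∉ _  x∉ (yes x∈) = contradiction x∈ x∉
  pick-∉ Px _  (no _)   = cong (_ ,_) (irr _ Px)

  φ-surjective : ∀ y → Dec (Orbit (proj₁ y)) → ∃[ x ] φ x ≡ y
  φ-surjective (y , Py) (no y∉) = y , pick-∉ Py y∉ em
  φ-surjective (y , Py) (yes (base ¬Py)) = contradiction Py ¬Py
  φ-surjective (_ , Py) (yes (step {x} x∈)) =
    x , trans (pick-∈ x∈ em) (cong (_ ,_) (irr _ Py))

-- Initial ordinals and cofinality.

module _ (em : ExcludedMiddle ℓ) where

  no-injection-↓ : (μ : Cardinal ℓ) {a : ∣ μ ∣} → ¬ (∣ μ ∣ ↣ Ordinal.Carrier (ord μ ↓ a))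
  no-injection-↓ μ {a} j = Cardinal.initial μ a
    (sym-≡ (injection-into-subset em (Cardinal.<-irrelevant μ) j))

  -- Let `x` in `μ` correspond to `a`. A section of `t` embeds `μ` in `α ↓ a`, hence in its own
  -- proper segment `μ ↓ x`.
  no-surjection-from-smaller : (α : Ordinal ℓ) {a b : Ordinal.Carrier α} (μ : Cardinal ℓ) →
    ord μ ≅ α ↓ b → Ordinal._<_ α a b →
    (t : Ordinal.Carrier (α ↓ a) → ∣ μ ∣) → ¬ StrictlySurjective _≡_ t
  no-surjection-from-smaller α {a} {b} μ (f , iso) a<b t t-surj =
    no-injection-↓ μ {x} (mk↣ incl-injective ↣-∘ liftInjection (mk↠ₛ t-surj) id id)
    where
    open IsOrderIsomorphism iso using (cancel; surjective)
    open Ordinal α using (<-trans; <-irrelevant)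

    preimage : ∀ z → ∃[ y ] f y ≡ z
    preimage z = proj₁ (surjective z) , proj₂ (surjective z) refl

    x : ∣ μ ∣
    x = proj₁ (preimage (a , a<b))

    incl : Ordinal.Carrier (α ↓ a) → Ordinal.Carrier (ord μ ↓ x)
    incl (z , z<a) = y , cancel (subst₂ (λ u v → Ordinal._<_ α (proj₁ u) (proj₁ v))
                                        (sym fy≡z) (sym (proj₂ (preimage (a , a<b)))) z<a)
      where
      y    = proj₁ (preimage (z , <-trans z<a a<b))
      fy≡z = proj₂ (preimage (z , <-trans z<a a<b))

    incl-injective : ∀ {p q} → incl p ≡ incl q → p ≡ q
    incl-injective {z , z<a} {w , w<a} eq with
      trans (sym (proj₂ (preimage (z , <-trans z<a a<b))))
        (trans (cong (f ∘ proj₁) eq) (proj₂ (preimage (w , <-trans w<a a<b))))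
    ... | e with cong proj₁ e
    ... | refl = cong (z ,_) (<-irrelevant z<a w<a)

  -- Minimality of `θ` bounds `c` on each proper initial segment, since otherwise `θ ↓ ε` would
  -- already carry a cofinal map. So running suprema of `c` exist.
  monotoneCofinalMap : (θ α : Ordinal ℓ) → IsCofinality θ α →
    ∃[ c ] c Preserves Ordinal._≤_ θ ⟶ Ordinal._≤_ α × (∀ a → ∃[ e ] Ordinal._≤_ α a (c e))
  monotoneCofinalMap θ α ((c , c-cofinal) , θ-minimal) =
    sup , sup-mono , λ a → proj₁ (c-cofinal a) ,
      ≤-trans (proj₂ (c-cofinal a)) (sup-bound _ _ (inj₂ refl))
    where
    open Ordinal α
    open OrdinalProperties α
    module Θ = Ordinal θ
    module Θₚ = OrdinalProperties θ

    -- Including `δ = ε` ensures `c ε ≤ sup ε`, so `sup` inherits cofinality.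
    Bound : Θ.Carrier → Pred Carrier _
    Bound ε a = ∀ δ → δ Θ.≤ ε → c δ ≤ a

    strictlyBelow : ∀ ε → ∃[ a ] (∀ δ → δ Θ.< ε → c δ ≤ a)
    strictlyBelow ε = em⇒dne em λ unbounded →
      Θₚ.≰ᵒ↓ (θ-minimal (θ ↓ ε)
        ( c ∘ proj₁
        , λ a → em⇒dne em λ ¬above →
            unbounded (a , λ _ δ<ε → inj₁ (≰⇒> λ a≤cδ → ¬above ((_ , δ<ε) , a≤cδ)))))

    bounded : ∀ ε → Satisfiable (Bound ε)
    bounded ε with strictlyBelow ε
    ... | a , below with upperBound a (c ε)
    ...   | b , a≤b , cε≤b = b , λ δ → [ (λ δ<ε → ≤-trans (below δ δ<ε) a≤b) , (λ { refl → cε≤b }) ]′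

    sup : Θ.Carrier → Carrier
    sup ε = proj₁ (least em (Bound ε) (bounded ε))

    sup-bound : ∀ ε → Bound ε (sup ε)
    sup-bound ε = proj₁ (proj₂ (least em (Bound ε) (bounded ε)))

    sup-mono : ∀ {δ ε} → δ Θ.≤ ε → sup δ ≤ sup ε
    sup-mono {δ} {ε} δ≤ε = proj₂ (proj₂ (least em (Bound δ) (bounded δ)))
      λ γ γ≤δ → sup-bound ε γ (Θₚ.≤-trans γ≤δ δ≤ε)

-- The composite of the two isomorphisms maps `α ↓ a` strictly increasingly below `g y`, so
-- `a ≤ g y < b`.
↓<ᵒ⇒< : (α β : Ordinal ℓ) {a b : Ordinal.Carrier α} →
         α ↓ a <ᵒ β → β ≅ α ↓ b → Ordinal._<_ α a b
↓<ᵒ⇒< α _ (y , f , f-iso) (g , g-iso) =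
  ≤-<-trans (↓-strictBound (proj₁ ∘ g ∘ proj₁ ∘ f) (G.mono ∘ F.mono) (G.mono ∘ proj₂ ∘ f))
            (proj₂ (g y))
  where
  open OrdinalProperties α
  module F = IsOrderIsomorphism f-iso
  module G = IsOrderIsomorphism g-iso

theorem2p2 : {ℓ : Level} → ExcludedMiddle ℓ → Extensionality ℓ ℓ →
    (κ Λ : Cardinal ℓ) (θ : Ordinal ℓ) (λs : ∣ κ ∣ → Cardinal ℓ) →
    (D : Pred (Pred ∣ κ ∣ ℓ) ℓ) →
    Infinite κ →
    IsCofinality θ (ord Λ) → θ ≤ᵒ ord κ → ord κ <ᵒ ord Λ →
    (∀ i → Infinite (λs i)) →
    IsLimitAlong D λs Λ →
    (∀ i → ∃[ ν ] HasCardinality (∣ κ ∣ →-setoid ∣ λs i ∣) ν × ord ν <ᵒ ord Λ) →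
    (isUF : IsUltrafilter D) →
    NotClosedUnderDescending D θ →
    HasCardinality (Ultraproduct isUF (λ i → ∣ λs i ∣)) Λ →
    WeaklyNormal θ D
theorem2p2 em _ κ Λ θ λs D _ cof _ κ<Λ _ lim powers isUF _ card = g , g-unbounded , normal
  where
  open IsUltrafilter isUF
  open Cardinal Λ using (_<_; _≤_)
  open OrdinalProperties (ord Λ)
  module Θ = Ordinal θ
  module Θₚ = OrdinalProperties θ

  c : Θ.Carrier → ∣ Λ ∣
  c = proj₁ (monotoneCofinalMap em θ (ord Λ) cof)

  c-mono : ∀ {δ ε} → δ Θ.≤ ε → c δ ≤ c ε
  c-mono = proj₁ (proj₂ (monotoneCofinalMap em θ (ord Λ) cof))

  c-cofinal : ∀ a → ∃[ e ] a ≤ c e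
  c-cofinal = proj₂ (proj₂ (monotoneCofinalMap em θ (ord Λ) cof))

  a₀ : ∣ Λ ∣
  a₀ = proj₁ κ<Λ

  -- Constant functions embed `λs i` in its power, of size below `Λ`; they are told apart at the
  -- point `i` of `κ`. This makes the bound `λs i ≤ᵒ Λ` from the limit strict.
  λs≇Λ : ∀ i → ¬ (ord (λs i) ≅ ord Λ)
  λs≇Λ i λsᵢ≅Λ with powers i
  ... | ν , ν-card , b , ν≅Λ↓b = no-injection-↓ em Λ
    (Bijection.injection (≅⇒⤖ (ord ν) (ord Λ ↓ b) ν≅Λ↓b)
      ↣-∘ (liftInjection (Bijection.surjection ν-card) const (λ eq → eq i)
      ↣-∘ liftInjection (Bijection.surjection (≅⇒⤖ (ord (λs i)) (ord Λ) λsᵢ≅Λ)) id id))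

  -- The order type of λs i as an element of Λ, with junk value a₀ when
  -- λs i is not below Λ.
  b : ∣ κ ∣ → ∣ Λ ∣
  b i with em {ord (λs i) <ᵒ ord Λ}
  ... | yes (b , _) = b
  ... | no _        = a₀

  b-spec : ∀ i → ord (λs i) <ᵒ ord Λ → ord (λs i) ≅ ord Λ ↓ b i
  b-spec i λsᵢ<Λ with em {ord (λs i) <ᵒ ord Λ}
  ... | yes (_ , iso) = iso
  ... | no λsᵢ≮Λ      = contradiction λsᵢ<Λ λsᵢ≮Λ

  b-limit : ∀ a → (λ i → ord (λs i) <ᵒ ord Λ × a < b i) ∈ D
  b-limit a = ⊆-closed below (lim (ord Λ ↓ a) (a , ≅-refl))
    where
    ≅-refl : ord Λ ↓ a ≅ ord Λ ↓ a
    ≅-refl = id , record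
      { isOrderMonomorphism = record
        { isOrderHomomorphism = record { cong = id ; mono = id }
        ; injective = id ; cancel = id }
      ; surjective = λ y → y , id }

    below : ∀ {i} → ord Λ ↓ a <ᵒ ord (λs i) × ord (λs i) ≤ᵒ ord Λ →
            ord (λs i) <ᵒ ord Λ × a < b i
    below {i} (a<λsᵢ , inj₁ λsᵢ<Λ) = λsᵢ<Λ , ↓<ᵒ⇒< (ord Λ) (ord (λs i)) a<λsᵢ (b-spec i λsᵢ<Λ)
    below {i} (_ , inj₂ λsᵢ≅Λ)     = contradiction λsᵢ≅Λ (λs≇Λ i)

  leastIndex : ∀ i → ∃[ ε ] b i ≤ c ε × (∀ {δ} → b i ≤ c δ → ε Θ.≤ δ)
  leastIndex i = Θₚ.least em (λ ε → b i ≤ c ε) (c-cofinal (b i))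

  g : ∣ κ ∣ → Θ.Carrier
  g = proj₁ ∘ leastIndex

  b≤c∘g : ∀ i → b i ≤ c (g i)
  b≤c∘g i = proj₁ (proj₂ (leastIndex i))

  -- This direction is leastness of `g i`; the converse below is where monotonicity of `c` enters.
  <g⇒c<b : ∀ {i ε} → ε Θ.< g i → c ε < b i
  <g⇒c<b {i} ε<g = ≰⇒> λ b≤cε → Θₚ.≤⇒≯ (proj₂ (proj₂ (leastIndex i)) b≤cε) ε<g

  c<b⇒<g : ∀ {i ε} → c ε < b i → ε Θ.< g i
  c<b⇒<g {i} cε<b = Θₚ.≰⇒> λ g≤ε → ≤⇒≯ (≤-trans (b≤c∘g i) (c-mono g≤ε)) cε<b

  g-unbounded : ∀ ε → (λ i → ε Θ.≤ g i) ∈ D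
  g-unbounded ε = ⊆-closed (λ (_ , cε<b) → inj₁ (c<b⇒<g cε<b)) (b-limit (c ε))

  -- Cofinality alone gives only `≤`. Sets in `D` are nonempty, so some `b i` exceeds `a`, and
  -- `b i ≤ c (g i)`.
  c-unbounded : ∀ a → ∃[ e ] a < c e
  c-unbounded a = em⇒dne em λ none →
    ∅∉ (⊆-closed (λ {i} (_ , a<b) → contradiction (g i , <-≤-trans a<b (b≤c∘g i)) none) (b-limit a))

  module F = Bijection card

  normal : ∀ f → Regressive θ g f → ∃[ j ] (λ i → f i Θ.< j) ∈ D
  normal f f-regressive = em⇒dne em λ unbounded →
    let a , Fa≈h = F.strictlySurjective h
        e , a<ce = c-unbounded a
        f≥e      = [ (λ f<e → contradiction (e , f<e) unbounded) , id ]′ (ultra (λ i → f i Θ.< e))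
    in ∅∉ (⊆-closed
         (λ {i} (Fai≡hi , f≮e , λsᵢ<Λ , c₀<b) → contradiction Fai≡hi
            (h-avoids i λsᵢ<Λ (<g⇒c<b (f-regressive i (_ , c<b⇒<g c₀<b))) a
               (<-≤-trans a<ce (c-mono (Θₚ.≮⇒≥ f≮e)))))
         -- Any index of `θ` serves here: it lies below `g i` on the last set, which supplies the
         -- positivity premise of regressivity.
         (∩-closed Fa≈h (∩-closed f≥e (b-limit (c (proj₁ (c-cofinal a₀)))))))
    where
    -- The premises are built in so that `h` can be chosen at every `i`, not just at `D`-almost all.
    Avoids : ∀ i → Pred ∣ λs i ∣ _
    Avoids i x = ord (λs i) <ᵒ ord Λ → c (f i) < b i → ∀ a → a < c (f i) → F.to a i ≢ x

    avoiding : ∀ i → Satisfiable (Avoids i)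
    avoiding i = em⇒dne em λ none →
      -- The trial point `F.to a₀ i` brings the two premises into scope. If no point avoids, the
      -- values `F.to a i` with `a < c (f i)` exhaust `λs i`, whose order type `b i` is larger than
      -- `c (f i)`.
      none (F.to a₀ i , λ λsᵢ<Λ c<b → contradiction
        (λ x → em⇒dne em λ missed → none (x , λ _ _ _ a<c eq → missed ((_ , a<c) , eq)))
        (no-surjection-from-smaller em (ord Λ) (λs i) (b-spec i λsᵢ<Λ) c<b (λ (a , _) → F.to a i)))

    h : ∀ i → ∣ λs i ∣
    h i = proj₁ (avoiding i)

    h-avoids : ∀ i → Avoids i (h i)
    h-avoids i = proj₂ (avoiding i)
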